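{- There is an absolute constant $c>0$ such that the following holds. Let $q\in(0,1)$ and let $D>1$ be an integer such that $qD$ is a positive integer. Then every (possibly randomized) online algorithm with predictions for the page migration problem with parameter $D$ on uniform metric spaces has competitive ratio at least $1+cq$ on the class of inputs in which every interval of $D$ consecutive indices contains at most $qD$ mismatches between the predicted and the actual sequence.
   Context: Page migration problem. Let $(X,d)$ be a metric space, $D>1$ a parameter, and $p_0\in X$ a start position. For a request sequence $s=(s_1,\dots,s_n)\in X^n$ and page positions $a=(a_1,\dots,a_n)\in X^n$, with $a_0:=p_0$, the cost of $a$ on $s$ is $\sum_{i=1}^n \left(D\, d(a_{i-1},a_i)+d(a_i,s_i)\right)$. A metric space is uniform if $d(p,p')=1$ for all $p\ne p'$. Online algorithm with predictions. An input consists of $p_0$, $n$, a predicted sequence $\hat s\in X^n$ and an actual sequence $s\in X^n$. The algorithm knows $p_0,n,\hat s$ in advance but sees $s$ online: $a_i$ depends only on $p_0,n,\hat s,s_1,\dots,s_i$ (and on internal randomness if randomized). A mismatch is an index $t$ with $s_t\neq\hat s_t$. The algorithm is $\rho$-competitive on a class of inputs if for every input in the class (with any uniform metric space) its (expected) cost on $s$ is at most $\rho$ times the optimal offline cost for $s$, i.e. the infimum over all $a\in X^n$ of the cost of $a$ on $s$. Its competitive ratio on the class is the infimum of such $\rho$. -}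

module Defs where

open import Data.Bool.Base using (Bool; true; false; not; _∧_; _∨_)
open import Data.Fin.Base using (Fin; toℕ)
open import Data.Integer.Base using (+_)
open import Data.List.Base using (length; filter; allFin)
open import Data.Nat.Base as ℕ using (ℕ; zero; suc)
import Data.Nat.Properties as ℕₚ
open import Data.Product.Base using (Σ-syntax; ∃-syntax; _×_; _,_)
open import Data.Rational.Base as ℚ using (ℚ; 0ℚ; 1ℚ; ½)
import Data.Rational.Properties as ℚₚ
open import Data.Rational.Solver using (module +-*-Solver)
open import Data.Vec.Base using (Vec; []; _∷_; lookup)
open import Function.Metric.Nat.Structures using (IsMetric)
open import Relation.Binary.Definitions using (DecidableEquality)
open import Relation.Binary.PropositionalEquality
  using (_≡_; _≢_; _≗_; refl; sym; trans; cong; cong₂; subst)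
open import Relation.Nullary.Decidable
  using (yes; no; map′; ¬?; _×-dec_)

------------------------------------------------------------------------
-- Real numbers, as Cauchy sequences of rationals with setoid equality _≃_

record ℝ : Set where
  constructor mkℝ
  field
    seq    : ℕ → ℚ
    cauchy : ∀ ε → 0ℚ ℚ.< ε →
             ∃[ N ] (∀ m n → N ℕ.≤ m → N ℕ.≤ n →
                     ℚ.∣ seq m ℚ.- seq n ∣ ℚ.≤ ε)

open ℝ public

infix  4 _≤_ _<_ _≃_
infixl 6 _+_
infixl 7 _*_

_≤_ : ℝ → ℝ → Set
x ≤ y = ∀ ε → 0ℚ ℚ.< ε →
        ∃[ N ] (∀ n → N ℕ.≤ n → seq x n ℚ.≤ seq y n ℚ.+ ε)

_<_ : ℝ → ℝ → Set
x < y = Σ[ ε ∈ ℚ ] (0ℚ ℚ.< ε ×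
        ∃[ N ] (∀ n → N ℕ.≤ n → seq x n ℚ.+ ε ℚ.≤ seq y n))

_≃_ : ℝ → ℝ → Set
x ≃ y = x ≤ y × y ≤ x

fromℚ : ℚ → ℝ
fromℚ p .seq    _     = p
fromℚ p .cauchy ε 0<ε = 0 , λ _ _ _ _ →
  subst (ℚ._≤ ε) (sym (cong ℚ.∣_∣ (ℚₚ.+-inverseʳ p))) (ℚₚ.<⇒≤ 0<ε)

fromℕ : ℕ → ℝ
fromℕ n = fromℚ ((+ n) ℚ./ 1)

0ℝ 1ℝ : ℝ
0ℝ = fromℚ 0ℚ
1ℝ = fromℚ 1ℚ

private
  0<½*_ : ∀ {ε} → 0ℚ ℚ.< ε → 0ℚ ℚ.< ½ ℚ.* ε
  0<½*_ {ε} 0<ε =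
    ℚₚ.positive⁻¹ (½ ℚ.* ε) {{ℚₚ.pos*pos⇒pos ½ ε {{ℚ.positive 0<ε}}}}

  halves : ∀ ε → ½ ℚ.* ε ℚ.+ ½ ℚ.* ε ≡ ε
  halves ε = trans (sym (ℚₚ.*-distribʳ-+ ε ½ ½)) (ℚₚ.*-identityˡ ε)

_+_ : ℝ → ℝ → ℝ
(x + y) .seq n = seq x n ℚ.+ seq y n
(x + y) .cauchy ε 0<ε
  with cauchy x (½ ℚ.* ε) (0<½* 0<ε) | cauchy y (½ ℚ.* ε) (0<½* 0<ε)
... | M , hx | N , hy = M ℕ.⊔ N , λ m n M⊔N≤m M⊔N≤n → begin
    ℚ.∣ (seq x m ℚ.+ seq y m) ℚ.- (seq x n ℚ.+ seq y n) ∣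
      ≡⟨ cong ℚ.∣_∣ (regroup (seq x m) (seq y m) (seq x n) (seq y n)) ⟩
    ℚ.∣ (seq x m ℚ.- seq x n) ℚ.+ (seq y m ℚ.- seq y n) ∣
      ≤⟨ ℚₚ.∣p+q∣≤∣p∣+∣q∣ (seq x m ℚ.- seq x n) (seq y m ℚ.- seq y n) ⟩
    ℚ.∣ seq x m ℚ.- seq x n ∣ ℚ.+ ℚ.∣ seq y m ℚ.- seq y n ∣
      ≤⟨ ℚₚ.+-mono-≤
           (hx m n (ℕₚ.m⊔n≤o⇒m≤o M N M⊔N≤m) (ℕₚ.m⊔n≤o⇒m≤o M N M⊔N≤n))
           (hy m n (ℕₚ.m⊔n≤o⇒n≤o M N M⊔N≤m) (ℕₚ.m⊔n≤o⇒n≤o M N M⊔N≤n)) ⟩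
    ½ ℚ.* ε ℚ.+ ½ ℚ.* ε
      ≡⟨ halves ε ⟩
    ε ∎
  where
  open ℚₚ.≤-Reasoning
  open +-*-Solver
  regroup : ∀ a b c d → (a ℚ.+ b) ℚ.- (c ℚ.+ d) ≡ (a ℚ.- c) ℚ.+ (b ℚ.- d)
  regroup = solve 4 (λ a b c d →
    (a :+ b) :- (c :+ d) := (a :- c) :+ (b :- d)) refl

private
  eventuallyBounded : ∀ x → ∃[ N ] Σ[ B ∈ ℚ ] (0ℚ ℚ.< B ×
                      (∀ n → N ℕ.≤ n → ℚ.∣ seq x n ∣ ℚ.≤ B))
  eventuallyBounded x with cauchy x 1ℚ (ℚₚ.positive⁻¹ 1ℚ)
  ... | N , h = N , 1ℚ ℚ.+ ℚ.∣ seq x N ∣ ,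
        ℚₚ.+-mono-<-≤ (ℚₚ.positive⁻¹ 1ℚ) (ℚₚ.0≤∣p∣ (seq x N)) ,
        λ n N≤n → begin
    ℚ.∣ seq x n ∣
      ≡⟨ cong ℚ.∣_∣ (split (seq x n) (seq x N)) ⟩
    ℚ.∣ (seq x n ℚ.- seq x N) ℚ.+ seq x N ∣
      ≤⟨ ℚₚ.∣p+q∣≤∣p∣+∣q∣ (seq x n ℚ.- seq x N) (seq x N) ⟩
    ℚ.∣ seq x n ℚ.- seq x N ∣ ℚ.+ ℚ.∣ seq x N ∣
      ≤⟨ ℚₚ.+-monoˡ-≤ ℚ.∣ seq x N ∣ (h n N N≤n ℕₚ.≤-refl) ⟩
    1ℚ ℚ.+ ℚ.∣ seq x N ∣ ∎
    where
    open ℚₚ.≤-Reasoning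
    open +-*-Solver
    split : ∀ a b → a ≡ (a ℚ.- b) ℚ.+ b
    split = solve 2 (λ a b → a := (a :- b) :+ b) refl

private
  scaleDown : ∀ {B ε} → 0ℚ ℚ.< B → 0ℚ ℚ.< ε →
              Σ[ δ ∈ ℚ ] (0ℚ ℚ.< δ × B ℚ.* δ ≡ ε)
  scaleDown {B} {ε} 0<B 0<ε = 1/B ℚ.* ε , 0<δ ,
    trans (sym (ℚₚ.*-assoc B 1/B ε))
      (trans (cong (ℚ._* ε) (ℚₚ.*-inverseʳ B {{B≢0}}))
             (ℚₚ.*-identityˡ ε))
    where
    B≢0 : ℚ.NonZero B
    B≢0 = ℚₚ.pos⇒nonZero B {{ℚ.positive 0<B}}
    1/B : ℚ
    1/B = (ℚ.1/ B) {{B≢0}}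
    0<δ : 0ℚ ℚ.< 1/B ℚ.* ε
    0<δ = ℚₚ.positive⁻¹ (1/B ℚ.* ε) {{ℚₚ.pos*pos⇒pos 1/B
      {{ℚₚ.1/pos⇒pos B {{ℚ.positive 0<B}}}} ε {{ℚ.positive 0<ε}}}}

  *-mono-≤-nonNeg : ∀ {a b c d} → 0ℚ ℚ.≤ b → 0ℚ ℚ.≤ c →
                    a ℚ.≤ b → c ℚ.≤ d → a ℚ.* c ℚ.≤ b ℚ.* d
  *-mono-≤-nonNeg {b = b} {c = c} 0≤b 0≤c a≤b c≤d = ℚₚ.≤-trans
    (ℚₚ.*-monoʳ-≤-nonNeg c {{ℚ.nonNegative 0≤c}} a≤b)
    (ℚₚ.*-monoˡ-≤-nonNeg b {{ℚ.nonNegative 0≤b}} c≤d)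

  ∣ab-cd∣≤ : ∀ {A B δ} a b c d → 0ℚ ℚ.≤ A → 0ℚ ℚ.≤ B →
             ℚ.∣ a ∣ ℚ.≤ A → ℚ.∣ d ∣ ℚ.≤ B →
             ℚ.∣ a ℚ.- c ∣ ℚ.≤ δ → ℚ.∣ b ℚ.- d ∣ ℚ.≤ δ →
             ℚ.∣ a ℚ.* b ℚ.- c ℚ.* d ∣ ℚ.≤ (A ℚ.+ B) ℚ.* δ
  ∣ab-cd∣≤ {A} {B} {δ} a b c d 0≤A 0≤B ∣a∣≤A ∣d∣≤B ∣a-c∣≤δ ∣b-d∣≤δ = begin
    ℚ.∣ a ℚ.* b ℚ.- c ℚ.* d ∣
      ≡⟨ cong ℚ.∣_∣ (regroup a b c d) ⟩
    ℚ.∣ a ℚ.* (b ℚ.- d) ℚ.+ d ℚ.* (a ℚ.- c) ∣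
      ≤⟨ ℚₚ.∣p+q∣≤∣p∣+∣q∣ (a ℚ.* (b ℚ.- d)) (d ℚ.* (a ℚ.- c)) ⟩
    ℚ.∣ a ℚ.* (b ℚ.- d) ∣ ℚ.+ ℚ.∣ d ℚ.* (a ℚ.- c) ∣
      ≡⟨ cong₂ ℚ._+_ (ℚₚ.∣p*q∣≡∣p∣*∣q∣ a (b ℚ.- d))
                     (ℚₚ.∣p*q∣≡∣p∣*∣q∣ d (a ℚ.- c)) ⟩
    ℚ.∣ a ∣ ℚ.* ℚ.∣ b ℚ.- d ∣ ℚ.+ ℚ.∣ d ∣ ℚ.* ℚ.∣ a ℚ.- c ∣
      ≤⟨ ℚₚ.+-mono-≤
           (*-mono-≤-nonNeg 0≤A (ℚₚ.0≤∣p∣ (b ℚ.- d)) ∣a∣≤A ∣b-d∣≤δ)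
           (*-mono-≤-nonNeg 0≤B (ℚₚ.0≤∣p∣ (a ℚ.- c)) ∣d∣≤B ∣a-c∣≤δ) ⟩
    A ℚ.* δ ℚ.+ B ℚ.* δ
      ≡⟨ ℚₚ.*-distribʳ-+ δ A B ⟨
    (A ℚ.+ B) ℚ.* δ ∎
    where
    open ℚₚ.≤-Reasoning
    open +-*-Solver
    regroup : ∀ a b c d → a ℚ.* b ℚ.- c ℚ.* d ≡
                          a ℚ.* (b ℚ.- d) ℚ.+ d ℚ.* (a ℚ.- c)
    regroup = solve 4 (λ a b c d →
      a :* b :- c :* d := a :* (b :- d) :+ d :* (a :- c)) refl

  abstract
    *-cauchy : ∀ x y ε → 0ℚ ℚ.< ε →
               ∃[ N ] (∀ m n → N ℕ.≤ m → N ℕ.≤ n →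
                 ℚ.∣ seq x m ℚ.* seq y m ℚ.- seq x n ℚ.* seq y n ∣ ℚ.≤ ε)
    *-cauchy x y ε 0<ε =
      let N₁ , A , 0<A , hA = eventuallyBounded x
          N₂ , B , 0<B , hB = eventuallyBounded y
          δ , 0<δ , [A+B]δ≡ε = scaleDown (ℚₚ.+-mono-< 0<A 0<B) 0<ε
          N₃ , hx = cauchy x δ 0<δ
          N₄ , hy = cauchy y δ 0<δ
          N₁₂≤ : ∀ {n} → (N₁ ℕ.⊔ N₂) ℕ.⊔ (N₃ ℕ.⊔ N₄) ℕ.≤ n → N₁ ℕ.⊔ N₂ ℕ.≤ n
          N₁₂≤ = ℕₚ.m⊔n≤o⇒m≤o (N₁ ℕ.⊔ N₂) (N₃ ℕ.⊔ N₄)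
          N₃₄≤ : ∀ {n} → (N₁ ℕ.⊔ N₂) ℕ.⊔ (N₃ ℕ.⊔ N₄) ℕ.≤ n → N₃ ℕ.⊔ N₄ ℕ.≤ n
          N₃₄≤ = ℕₚ.m⊔n≤o⇒n≤o (N₁ ℕ.⊔ N₂) (N₃ ℕ.⊔ N₄)
      in (N₁ ℕ.⊔ N₂) ℕ.⊔ (N₃ ℕ.⊔ N₄) , λ m n N≤m N≤n →
         ℚₚ.≤-trans
           (∣ab-cd∣≤ (seq x m) (seq y m) (seq x n) (seq y n)
             (ℚₚ.<⇒≤ 0<A) (ℚₚ.<⇒≤ 0<B)
             (hA m (ℕₚ.m⊔n≤o⇒m≤o N₁ N₂ (N₁₂≤ N≤m)))
             (hB n (ℕₚ.m⊔n≤o⇒n≤o N₁ N₂ (N₁₂≤ N≤n)))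
             (hx m n (ℕₚ.m⊔n≤o⇒m≤o N₃ N₄ (N₃₄≤ N≤m))
                     (ℕₚ.m⊔n≤o⇒m≤o N₃ N₄ (N₃₄≤ N≤n)))
             (hy m n (ℕₚ.m⊔n≤o⇒n≤o N₃ N₄ (N₃₄≤ N≤m))
                     (ℕₚ.m⊔n≤o⇒n≤o N₃ N₄ (N₃₄≤ N≤n))))
           (ℚₚ.≤-reflexive [A+B]δ≡ε)

_*_ : ℝ → ℝ → ℝ
x * y = mkℝ (λ n → seq x n ℚ.* seq y n) (*-cauchy x y)

∑[k≤_] : ℕ → (ℕ → ℝ) → ℝ
∑[k≤ zero  ] f = f 0
∑[k≤ suc n ] f = ∑[k≤ n ] f + f (suc n)

------------------------------------------------------------------------
-- Probability

-- Kolmogorov's axioms for a field of events (a subset of Ω is given by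
-- its characteristic function).  Closure under countable unions is not
-- required: for bounded integer random variables it plays no role, and a
-- probability on a field extends to the generated σ-field.
record ProbabilitySpace : Set₁ where
  field
    Ω       : Set
    IsEvent : (Ω → Bool) → Set
    ℙ       : (Ω → Bool) → ℝ

    event-cong : ∀ {A B} → A ≗ B → IsEvent A → IsEvent B
    event-Ω    : IsEvent (λ _ → true)
    event-∁    : ∀ {A} → IsEvent A → IsEvent (λ ω → not (A ω))
    event-∪    : ∀ {A B} → IsEvent A → IsEvent B →
                 IsEvent (λ ω → A ω ∨ B ω)

    ℙ-cong     : ∀ {A B} → IsEvent A → IsEvent B → A ≗ B → ℙ A ≃ ℙ B
    ℙ-nonneg   : ∀ {A} → IsEvent A → 0ℝ ≤ ℙ A
    ℙ-Ω        : ℙ (λ _ → true) ≃ 1ℝ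
    ℙ-additive : ∀ {A B} → IsEvent A → IsEvent B →
                 (∀ ω → A ω ∧ B ω ≡ false) →
                 ℙ (λ ω → A ω ∨ B ω) ≃ ℙ A + ℙ B
    -- Together with finite additivity this is countable additivity.
    ℙ-continuous : ∀ (A : ℕ → Ω → Bool) → (∀ n → IsEvent (A n)) →
                   (∀ n ω → A (suc n) ω ≡ true → A n ω ≡ true) →
                   (∀ ω → ∃[ n ] A n ω ≡ false) →
                   ∀ ε → 0ℚ ℚ.< ε →
                   ∃[ N ] (∀ n → N ℕ.≤ n → ℙ (A n) ≤ fromℚ ε)

module _ (P : ProbabilitySpace) where
  open ProbabilitySpace P

  record BoundedRV : Set where
    field
      value      : Ω → ℕ
      bound      : ℕ
      bounded    : ∀ ω → value ω ℕ.≤ bound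
      measurable : ∀ k → IsEvent (λ ω → value ω ℕ.≡ᵇ k)

  𝔼 : BoundedRV → ℝ
  𝔼 X = ∑[k≤ bound ] (λ k → fromℕ k * ℙ (λ ω → value ω ℕ.≡ᵇ k))
    where open BoundedRV X

------------------------------------------------------------------------
-- Page migration on uniform metric spaces

-- All distances in a uniform space are 0 or 1, so that ℕ-valued metrics
-- suffice.
record UniformMetricSpace : Set₁ where
  field
    Point    : Set
    d        : Point → Point → ℕ
    isMetric : IsMetric _≡_ d
    uniform  : ∀ {p p′} → p ≢ p′ → d p p′ ≡ 1

  open IsMetric isMetric public using (≈⇒0; 0⇒≈)

  _≟_ : DecidableEquality Point
  p ≟ p′ = map′ 0⇒≈ ≈⇒0 (d p p′ ℕₚ.≟ 0)

  d≤1 : ∀ p p′ → d p p′ ℕ.≤ 1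
  d≤1 p p′ with p ≟ p′
  ... | yes p≡p′ = subst (ℕ._≤ 1) (sym (≈⇒0 p≡p′)) ℕ.z≤n
  ... | no  p≢p′ = ℕₚ.≤-reflexive (uniform p≢p′)

module _ (X : UniformMetricSpace) (D : ℕ) where
  open UniformMetricSpace X

  cost : Point → ∀ {n} → Vec Point n → Vec Point n → ℕ
  cost p []       []       = 0
  cost p (a ∷ as) (s ∷ ss) = (D ℕ.* d p a ℕ.+ d a s) ℕ.+ cost a as ss

  cost-bounded : ∀ p {n} (as ss : Vec Point n) →
                 cost p as ss ℕ.≤ n ℕ.* (D ℕ.+ 1)
  cost-bounded p []       []       = ℕ.z≤n
  cost-bounded p (a ∷ as) (s ∷ ss) = ℕₚ.+-mono-≤
    (ℕₚ.+-mono-≤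
      (subst (D ℕ.* d p a ℕ.≤_) (ℕₚ.*-identityʳ D)
        (ℕₚ.*-monoʳ-≤ D (d≤1 p a)))
      (d≤1 a s))
    (cost-bounded a as ss)

  -- The infimum of the costs over all position sequences is `opt`.
  IsOfflineOptimum : Point → ∀ {n} → Vec Point n → ℕ → Set
  IsOfflineOptimum p₀ s opt =
    (∀ a → opt ℕ.≤ cost p₀ a s) ×
    (∀ l → (∀ a → l ℕ.≤ cost p₀ a s) → l ℕ.≤ opt)

  -- A deterministic algorithm is the case where Ω is the unit type.
  record OnlineAlgorithmOn : Set₁ where
    field
      randomness : ProbabilitySpace

    open ProbabilitySpace randomness public using (Ω; IsEvent)

    field
      positions : (p₀ : Point) (n : ℕ) (ŝ s : Vec Point n) →
                  Ω → Vec Point n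
      -- aᵢ does not depend on the requests after the i-th one.
      online    : ∀ p₀ n ŝ s s′ ω (i : Fin n) →
                  (∀ j → toℕ j ℕ.≤ toℕ i → lookup s j ≡ lookup s′ j) →
                  lookup (positions p₀ n ŝ s ω) i ≡
                  lookup (positions p₀ n ŝ s′ ω) i
      -- The cost is a random variable, so that its expectation exists.
      cost-measurable : ∀ p₀ n ŝ s k →
        IsEvent (λ ω → cost p₀ (positions p₀ n ŝ s ω) s ℕ.≡ᵇ k)

    costRV : (p₀ : Point) (n : ℕ) (ŝ s : Vec Point n) →
             BoundedRV randomness
    costRV p₀ n ŝ s = record
      { value      = λ ω → cost p₀ (positions p₀ n ŝ s ω) s
      ; bound      = n ℕ.* (D ℕ.+ 1)
      ; bounded    = λ ω → cost-bounded p₀ (positions p₀ n ŝ s ω) s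
      ; measurable = cost-measurable p₀ n ŝ s
      }

    expectedCost : (p₀ : Point) (n : ℕ) (ŝ s : Vec Point n) → ℝ
    expectedCost p₀ n ŝ s = 𝔼 randomness (costRV p₀ n ŝ s)

OnlineAlgorithm : ℕ → Set₁
OnlineAlgorithm D = ∀ X → OnlineAlgorithmOn X D

record Input : Set₁ where
  field
    space : UniformMetricSpace

  open UniformMetricSpace space public

  field
    p₀  : Point
    n   : ℕ
    ŝ s : Vec Point n

module _ {D : ℕ} (alg : OnlineAlgorithm D) (C : Input → Set) where

  Competitive : ℝ → Set₁
  Competitive ρ =
    ∀ (I : Input) → C I → let open Input I in
    ∀ opt → IsOfflineOptimum space D p₀ s opt →
    OnlineAlgorithmOn.expectedCost (alg space) p₀ n ŝ s ≤ ρ * fromℕ opt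

  -- The infimum of all ρ with Competitive ρ is at least r (in the
  -- extended sense: it is +∞ if there is no such ρ).
  CompetitiveRatioAtLeast : ℝ → Set₁
  CompetitiveRatioAtLeast r = ∀ ρ → Competitive ρ → r ≤ ρ

-- The number of mismatches among the L consecutive (0-based) indices
-- t, …, t + L − 1.
mismatches : Input → (t L : ℕ) → ℕ
mismatches I t L = length (filter
  (λ i → (t ℕₚ.≤? toℕ i ×-dec toℕ i ℕₚ.<? t ℕ.+ L)
         ×-dec ¬? (lookup s i ≟ lookup ŝ i))
  (allFin n))
  where open Input I

MismatchesBounded : ℝ → ℕ → Input → Set
MismatchesBounded q D I =
  ∀ t → t ℕ.+ D ℕ.≤ Input.n I → fromℕ (mismatches I t D) ≤ q * fromℕ D

{-# OPTIONS --safe #-}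
module Submission where

-- On two points at distance 1, start at 0 and request 1 for D steps, then
-- request either 1 or 0 for k = qD further steps; the prediction always
-- continues with 1.  Both inputs have optimum D: move at once, respectively
-- never move.  An algorithm cannot tell them apart during the first D steps,
-- and for every outcome of its randomness its two costs sum to at least
-- 2D + k, so one of the expected costs is at least (1 + q/2) D.

open import Defs
open import Data.Bool.Base using (Bool; true; false; not; _∧_; _∨_)
open import Data.Bool.Properties using (∨-inverseʳ; ∧-inverseʳ)
open import Data.Empty using (⊥-elim)
open import Data.Fin.Base using (Fin; zero; suc; toℕ)
open import Data.Integer.Base as ℤ using (+_)
import Data.Integer.Properties as ℤₚ
import Data.List.Base as List
import Data.List.Properties as Listₚ
open import Data.Nat.Base as ℕ using (ℕ; zero; suc)
import Data.Nat.Properties as ℕₚ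
import Data.Nat.Solver as ℕ-Solver
open import Data.Product.Base using (Σ-syntax; ∃-syntax; _×_; _,_; proj₁; proj₂)
open import Data.Rational.Base as ℚ using (ℚ; 0ℚ; 1ℚ; ½)
import Data.Rational.Properties as ℚₚ
import Data.Rational.Solver as ℚ-Solver
import Data.Rational.Unnormalised.Base as ℚᵘ
import Data.Rational.Unnormalised.Properties as ℚᵘₚ
open import Data.Vec.Base using (Vec; []; _∷_; _++_; lookup; replicate; splitAt)
open import Data.Vec.Properties using (lookup-++-<)
open import Function.Base using (_∘_; id)
open import Function.Metric.Nat.Structures using (IsMetric)
open import Relation.Binary.Bundles using (Preorder)
open import Relation.Binary.PropositionalEquality
  using (_≡_; _≗_; refl; sym; trans; cong; cong₂; subst; isEquivalence; module ≡-Reasoning)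
import Relation.Binary.Reasoning.Preorder as ≲-Reasoning
open import Relation.Nullary.Decidable using (yes; no; from-no)
open import Relation.Nullary.Negation using (¬_; contradiction)
open import Relation.Unary using (Decidable)

-- Order and arithmetic of real numbers

infix 4 _≐_

-- Termwise equality, finer than `_≃_`: every ring identity in ℚ lifts to it index by index, so it
-- serves as the equality of the reasoning chains below.
_≐_ : ℝ → ℝ → Set
x ≐ y = seq x ≗ seq y

≐⇒≤ : ∀ x y → x ≐ y → x ≤ y
≐⇒≤ x y x≐y ε 0<ε = 0 , λ n _ → begin
  seq x n            ≡⟨ x≐y n ⟩
  seq y n            ≡⟨ ℚₚ.+-identityʳ (seq y n) ⟨
  seq y n ℚ.+ 0ℚ     ≤⟨ ℚₚ.+-monoʳ-≤ (seq y n) (ℚₚ.<⇒≤ 0<ε) ⟩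
  seq y n ℚ.+ ε      ∎
  where open ℚₚ.≤-Reasoning

≤-refl : ∀ x → x ≤ x
≤-refl x = ≐⇒≤ x x (λ _ → refl)

private
  0<½* : ∀ {ε} → 0ℚ ℚ.< ε → 0ℚ ℚ.< ½ ℚ.* ε
  0<½* {ε} 0<ε =
    ℚₚ.positive⁻¹ (½ ℚ.* ε) {{ℚₚ.pos*pos⇒pos ½ ε {{ℚ.positive 0<ε}}}}

  halves : ∀ ε → ½ ℚ.* ε ℚ.+ ½ ℚ.* ε ≡ ε
  halves ε = trans (sym (ℚₚ.*-distribʳ-+ ε ½ ½)) (ℚₚ.*-identityˡ ε)

≤-trans : ∀ x y z → x ≤ y → y ≤ z → x ≤ z
≤-trans x y z x≤y y≤z ε 0<ε
  with x≤y (½ ℚ.* ε) (0<½* 0<ε) | y≤z (½ ℚ.* ε) (0<½* 0<ε)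
... | M , hM | N , hN = M ℕ.⊔ N , λ n M⊔N≤n → begin
  seq x n
    ≤⟨ hM n (ℕₚ.m⊔n≤o⇒m≤o M N M⊔N≤n) ⟩
  seq y n ℚ.+ ½ ℚ.* ε
    ≤⟨ ℚₚ.+-monoˡ-≤ (½ ℚ.* ε) (hN n (ℕₚ.m⊔n≤o⇒n≤o M N M⊔N≤n)) ⟩
  (seq z n ℚ.+ ½ ℚ.* ε) ℚ.+ ½ ℚ.* ε
    ≡⟨ ℚₚ.+-assoc (seq z n) (½ ℚ.* ε) (½ ℚ.* ε) ⟩
  seq z n ℚ.+ (½ ℚ.* ε ℚ.+ ½ ℚ.* ε)
    ≡⟨ cong (seq z n ℚ.+_) (halves ε) ⟩
  seq z n ℚ.+ ε ∎
  where open ℚₚ.≤-Reasoning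

ℝ-preorder : Preorder _ _ _
ℝ-preorder = record
  { Carrier    = ℝ
  ; _≈_        = _≐_
  ; _≲_        = _≤_
  ; isPreorder = record
    { isEquivalence = record
      { refl  = λ _ → refl
      ; sym   = λ x≐y n → sym (x≐y n)
      ; trans = λ x≐y y≐z n → trans (x≐y n) (y≐z n)
      }
    ; reflexive = λ {x} {y} → ≐⇒≤ x y
    ; trans     = λ {x} {y} {z} → ≤-trans x y z
    }
  }

module ℝ-Reasoning = ≲-Reasoning ℝ-preorder

+-mono-≤ : ∀ x y u v → x ≤ y → u ≤ v → x + u ≤ y + v
+-mono-≤ x y u v x≤y u≤v ε 0<ε
  with x≤y (½ ℚ.* ε) (0<½* 0<ε) | u≤v (½ ℚ.* ε) (0<½* 0<ε)
... | M , hM | N , hN = M ℕ.⊔ N , λ n M⊔N≤n → begin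
  seq x n ℚ.+ seq u n
    ≤⟨ ℚₚ.+-mono-≤ (hM n (ℕₚ.m⊔n≤o⇒m≤o M N M⊔N≤n))
                   (hN n (ℕₚ.m⊔n≤o⇒n≤o M N M⊔N≤n)) ⟩
  (seq y n ℚ.+ ½ ℚ.* ε) ℚ.+ (seq v n ℚ.+ ½ ℚ.* ε)
    ≡⟨ interchange (seq y n) (½ ℚ.* ε) (seq v n) (½ ℚ.* ε) ⟩
  (seq y n ℚ.+ seq v n) ℚ.+ (½ ℚ.* ε ℚ.+ ½ ℚ.* ε)
    ≡⟨ cong ((seq y n ℚ.+ seq v n) ℚ.+_) (halves ε) ⟩
  (seq y n ℚ.+ seq v n) ℚ.+ ε ∎
  where
  open ℚₚ.≤-Reasoning
  open ℚ-Solver.+-*-Solver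
  interchange : ∀ a b c d → (a ℚ.+ b) ℚ.+ (c ℚ.+ d) ≡ (a ℚ.+ c) ℚ.+ (b ℚ.+ d)
  interchange = solve 4 (λ a b c d →
    (a :+ b) :+ (c :+ d) := (a :+ c) :+ (b :+ d)) refl

+-monoʳ-≤ : ∀ x u v → u ≤ v → x + u ≤ x + v
+-monoʳ-≤ x u v = +-mono-≤ x x u v (≤-refl x)

+-monoˡ-≤ : ∀ u x y → x ≤ y → x + u ≤ y + u
+-monoˡ-≤ u x y x≤y = +-mono-≤ x y u u x≤y (≤-refl u)

+-cancelʳ-≤ : ∀ z x y → x + z ≤ y + z → x ≤ y
+-cancelʳ-≤ z x y h ε 0<ε with h ε 0<ε
... | N , hN = N , λ n N≤n → begin
  seq x n
    ≡⟨ cancel (seq x n) (seq z n) ⟩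
  (seq x n ℚ.+ seq z n) ℚ.- seq z n
    ≤⟨ ℚₚ.+-monoˡ-≤ (ℚ.- seq z n) (hN n N≤n) ⟩
  ((seq y n ℚ.+ seq z n) ℚ.+ ε) ℚ.- seq z n
    ≡⟨ cancel′ (seq y n) (seq z n) ε ⟩
  seq y n ℚ.+ ε ∎
  where
  open ℚₚ.≤-Reasoning
  open ℚ-Solver.+-*-Solver
  cancel : ∀ a c → a ≡ (a ℚ.+ c) ℚ.- c
  cancel = solve 2 (λ a c → a := (a :+ c) :- c) refl
  cancel′ : ∀ b c e → ((b ℚ.+ c) ℚ.+ e) ℚ.- c ≡ b ℚ.+ e
  cancel′ = solve 3 (λ b c e → ((b :+ c) :+ e) :- c := b :+ e) refl

-- The hypothesis is used with tolerance `ε * p`, which becomes `ε` once the positive factor `p` is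
-- cancelled in each term.
*-cancelʳ-≤-pos : ∀ p .{{_ : ℚ.Positive p}} x y →
                  x * fromℚ p ≤ y * fromℚ p → x ≤ y
*-cancelʳ-≤-pos p x y h ε 0<ε
  with h (ε ℚ.* p) (ℚₚ.positive⁻¹ (ε ℚ.* p)
                      {{ℚₚ.pos*pos⇒pos ε {{ℚ.positive 0<ε}} p}})
... | N , hN = N , λ n N≤n → ℚₚ.*-cancelʳ-≤-pos p (begin
  seq x n ℚ.* p              ≤⟨ hN n N≤n ⟩
  seq y n ℚ.* p ℚ.+ ε ℚ.* p  ≡⟨ ℚₚ.*-distribʳ-+ p (seq y n) ε ⟨
  (seq y n ℚ.+ ε) ℚ.* p      ∎)
  where open ℚₚ.≤-Reasoning

-- The operator `/` normalises fractions, so the identity does not hold by computation; it is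
-- checked on unnormalised rationals and pulled back.
/1-homo-+ : ∀ m n → (+ (m ℕ.+ n)) ℚ./ 1 ≡ (+ m) ℚ./ 1 ℚ.+ (+ n) ℚ./ 1
/1-homo-+ m n = ℚₚ.toℚᵘ-injective (begin
  ℚ.toℚᵘ ((+ (m ℕ.+ n)) ℚ./ 1)
    ≈⟨ ℚₚ.toℚᵘ-fromℚᵘ (ℚᵘ.mkℚᵘ (+ (m ℕ.+ n)) 0) ⟩
  ℚᵘ.mkℚᵘ (+ (m ℕ.+ n)) 0
    ≈⟨ ℚᵘ.*≡* (cong (ℤ._* + 1)
         (sym (cong₂ ℤ._+_ (ℤₚ.*-identityʳ (+ m)) (ℤₚ.*-identityʳ (+ n))))) ⟩
  ℚᵘ.mkℚᵘ (+ m) 0 ℚᵘ.+ ℚᵘ.mkℚᵘ (+ n) 0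
    ≈⟨ ℚᵘₚ.+-cong (ℚₚ.toℚᵘ-fromℚᵘ (ℚᵘ.mkℚᵘ (+ m) 0))
                  (ℚₚ.toℚᵘ-fromℚᵘ (ℚᵘ.mkℚᵘ (+ n) 0)) ⟨
  ℚ.toℚᵘ ((+ m) ℚ./ 1) ℚᵘ.+ ℚ.toℚᵘ ((+ n) ℚ./ 1)
    ≈⟨ ℚₚ.toℚᵘ-homo-+ ((+ m) ℚ./ 1) ((+ n) ℚ./ 1) ⟨
  ℚ.toℚᵘ ((+ m) ℚ./ 1 ℚ.+ (+ n) ℚ./ 1) ∎)
  where
  open import Relation.Binary.Reasoning.Setoid ℚᵘₚ.≃-setoid

fromℕ-homo-+ : ∀ m n → fromℕ (m ℕ.+ n) ≐ fromℕ m + fromℕ n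
fromℕ-homo-+ m n _ = /1-homo-+ m n

fromℕ-suc : ∀ n → fromℕ (suc n) ≐ fromℕ n + 1ℝ
fromℕ-suc n _ = trans (/1-homo-+ 1 n) (ℚₚ.+-comm 1ℚ ((+ n) ℚ./ 1))

0≤/1 : ∀ n → 0ℚ ℚ.≤ (+ n) ℚ./ 1
0≤/1 n = ℚₚ.nonNegative⁻¹ _ {{ℚₚ.normalize-nonNeg n 1}}

fromℕ-mono-≤ : ∀ {m n} → m ℕ.≤ n → fromℕ m ≤ fromℕ n
fromℕ-mono-≤ {m} {n} m≤n ε 0<ε = 0 , λ _ _ → begin
  (+ m) ℚ./ 1
    ≡⟨ ℚₚ.+-identityʳ _ ⟨
  (+ m) ℚ./ 1 ℚ.+ 0ℚ
    ≤⟨ ℚₚ.+-monoʳ-≤ ((+ m) ℚ./ 1) (0≤/1 (n ℕ.∸ m)) ⟩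
  (+ m) ℚ./ 1 ℚ.+ (+ (n ℕ.∸ m)) ℚ./ 1
    ≡⟨ /1-homo-+ m (n ℕ.∸ m) ⟨
  (+ (m ℕ.+ (n ℕ.∸ m))) ℚ./ 1
    ≡⟨ cong (λ j → (+ j) ℚ./ 1) (ℕₚ.m+[n∸m]≡n m≤n) ⟩
  (+ n) ℚ./ 1
    ≡⟨ ℚₚ.+-identityʳ _ ⟨
  (+ n) ℚ./ 1 ℚ.+ 0ℚ
    ≤⟨ ℚₚ.+-monoʳ-≤ ((+ n) ℚ./ 1) (ℚₚ.<⇒≤ 0<ε) ⟩
  (+ n) ℚ./ 1 ℚ.+ ε ∎
  where open ℚₚ.≤-Reasoning

1ℝ≰0ℝ : ¬ 1ℝ ≤ 0ℝ
1ℝ≰0ℝ 1≤0 with 1≤0 ½ (ℚₚ.positive⁻¹ ½)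
... | N , h = from-no (1ℚ ℚₚ.≤? 0ℚ ℚ.+ ½) (h N ℕₚ.≤-refl)

fromℕ-cancel-≤ : ∀ {m n} → fromℕ m ≤ fromℕ n → m ℕ.≤ n
fromℕ-cancel-≤ {m} {n} h with m ℕₚ.≤? n
... | yes m≤n = m≤n
-- The order on ℕ is decidable, so it suffices to refute `n < m`: it would give 1 + n ≤ n in ℝ, and
-- then 1 ≤ 0.
... | no  m≰n = ⊥-elim (1ℝ≰0ℝ (+-cancelʳ-≤ (fromℕ n) 1ℝ 0ℝ (begin
  1ℝ + fromℕ n    ≈⟨ fromℕ-homo-+ 1 n ⟨
  fromℕ (suc n)   ≲⟨ fromℕ-mono-≤ (ℕₚ.≰⇒> m≰n) ⟩
  fromℕ m         ≲⟨ h ⟩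
  fromℕ n         ≈⟨ (λ _ → ℚₚ.+-identityˡ _) ⟨
  0ℝ + fromℕ n    ∎)))
  where open ℝ-Reasoning

suc-*-distrib : ∀ n x → fromℕ (suc n) * x ≐ fromℕ n * x + x
suc-*-distrib n x i = begin
  (+ suc n) ℚ./ 1 ℚ.* seq x i
    ≡⟨ cong (ℚ._* seq x i) (fromℕ-suc n i) ⟩
  ((+ n) ℚ./ 1 ℚ.+ 1ℚ) ℚ.* seq x i
    ≡⟨ ℚₚ.*-distribʳ-+ (seq x i) ((+ n) ℚ./ 1) 1ℚ ⟩
  (+ n) ℚ./ 1 ℚ.* seq x i ℚ.+ 1ℚ ℚ.* seq x i
    ≡⟨ cong (((+ n) ℚ./ 1 ℚ.* seq x i) ℚ.+_) (ℚₚ.*-identityˡ (seq x i)) ⟩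
  (+ n) ℚ./ 1 ℚ.* seq x i ℚ.+ seq x i ∎
  where open ≡-Reasoning

-- Multiplication by a natural number is repeated addition, so monotonicity of `+` suffices and no
-- estimate for products of Cauchy sequences arises.
fromℕ-*-monoʳ-≤ : ∀ n x y → x ≤ y → fromℕ n * x ≤ fromℕ n * y
fromℕ-*-monoʳ-≤ zero    x y x≤y = ≐⇒≤ (fromℕ 0 * x) (fromℕ 0 * y) λ i →
  trans (ℚₚ.*-zeroˡ (seq x i)) (sym (ℚₚ.*-zeroˡ (seq y i)))
fromℕ-*-monoʳ-≤ (suc n) x y x≤y = begin
  fromℕ (suc n) * x  ≈⟨ suc-*-distrib n x ⟩
  fromℕ n * x + x    ≲⟨ +-mono-≤ (fromℕ n * x) (fromℕ n * y) x y
                          (fromℕ-*-monoʳ-≤ n x y x≤y) x≤y ⟩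
  fromℕ n * y + y    ≈⟨ suc-*-distrib n y ⟨
  fromℕ (suc n) * y  ∎
  where open ℝ-Reasoning

<⇒≤ : ∀ x y → x < y → x ≤ y
<⇒≤ x y (δ , 0<δ , N , h) ε 0<ε = N , λ n N≤n → begin
  seq x n          ≡⟨ ℚₚ.+-identityʳ _ ⟨
  seq x n ℚ.+ 0ℚ   ≤⟨ ℚₚ.+-monoʳ-≤ (seq x n) (ℚₚ.<⇒≤ 0<δ) ⟩
  seq x n ℚ.+ δ    ≤⟨ h n N≤n ⟩
  seq y n          ≡⟨ ℚₚ.+-identityʳ _ ⟨
  seq y n ℚ.+ 0ℚ   ≤⟨ ℚₚ.+-monoʳ-≤ (seq y n) (ℚₚ.<⇒≤ 0<ε) ⟩
  seq y n ℚ.+ ε    ∎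
  where open ℚₚ.≤-Reasoning

-- Finite sums of real numbers

∑[k<_] : ℕ → (ℕ → ℝ) → ℝ
∑[k< zero  ] f = 0ℝ
∑[k< suc n ] f = ∑[k< n ] f + f n

∑-head : ∀ n f → ∑[k< suc n ] f ≐ f 0 + ∑[k< n ] (f ∘ suc)
∑-head zero    f i = ℚₚ.+-comm 0ℚ (seq (f 0) i)
∑-head (suc n) f i = trans (cong (ℚ._+ seq (f (suc n)) i) (∑-head n f i))
  (ℚₚ.+-assoc (seq (f 0) i) _ (seq (f (suc n)) i))

-- The term `f i` is paired with `g (m - 1 - i)`, giving `m` pairs of sum at most 1. The induction
-- takes the last term of `f` and the first of `g`.
∑-antidiagonal-≤ : ∀ m f g → (∀ i j → suc (i ℕ.+ j) ≡ m → f i + g j ≤ 1ℝ) →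
                   ∑[k< m ] f + ∑[k< m ] g ≤ fromℕ m
∑-antidiagonal-≤ zero    f g h = ≐⇒≤ (0ℝ + 0ℝ) (fromℕ 0) (λ _ → refl)
∑-antidiagonal-≤ (suc m) f g h = begin
  (∑[k< m ] f + f m) + ∑[k< suc m ] g
    ≈⟨ (λ i → cong (seq (∑[k< suc m ] f) i ℚ.+_) (∑-head m g i)) ⟩
  (∑[k< m ] f + f m) + (g 0 + ∑[k< m ] (g ∘ suc))
    ≈⟨ (λ i → regroup (seq (∑[k< m ] f) i) (seq (f m) i) (seq (g 0) i) _) ⟩
  (∑[k< m ] f + ∑[k< m ] (g ∘ suc)) + (f m + g 0)
    ≲⟨ +-mono-≤ (∑[k< m ] f + ∑[k< m ] (g ∘ suc)) (fromℕ m) (f m + g 0) 1ℝ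
         (∑-antidiagonal-≤ m f (g ∘ suc) λ i j i+j+1≡m →
           h i (suc j) (cong suc (trans (ℕₚ.+-suc i j) i+j+1≡m)))
         (h m 0 (cong suc (ℕₚ.+-identityʳ m))) ⟩
  fromℕ m + 1ℝ
    ≈⟨ fromℕ-suc m ⟨
  fromℕ (suc m) ∎
  where
  open ℝ-Reasoning
  open ℚ-Solver.+-*-Solver
  regroup : ∀ a b c d → (a ℚ.+ b) ℚ.+ (c ℚ.+ d) ≡ (a ℚ.+ d) ℚ.+ (b ℚ.+ c)
  regroup = solve 4 (λ a b c d →
    (a :+ b) :+ (c :+ d) := (a :+ d) :+ (b :+ c)) refl

-- Expectations

<ᵇ-suc : ∀ v k → (v ℕ.<ᵇ suc k) ≡ (v ℕ.<ᵇ k) ∨ (v ℕ.≡ᵇ k)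
<ᵇ-suc zero    zero    = refl
<ᵇ-suc zero    (suc k) = refl
<ᵇ-suc (suc v) zero    = refl
<ᵇ-suc (suc v) (suc k) = <ᵇ-suc v k

<ᵇ∧≡ᵇ≡false : ∀ v k → (v ℕ.<ᵇ k) ∧ (v ℕ.≡ᵇ k) ≡ false
<ᵇ∧≡ᵇ≡false zero    zero    = refl
<ᵇ∧≡ᵇ≡false zero    (suc k) = refl
<ᵇ∧≡ᵇ≡false (suc v) zero    = refl
<ᵇ∧≡ᵇ≡false (suc v) (suc k) = <ᵇ∧≡ᵇ≡false v k

<⇒<ᵇ≡true : ∀ {m n} → m ℕ.< n → (m ℕ.<ᵇ n) ≡ true
<⇒<ᵇ≡true {m} {n} m<n with m ℕ.<ᵇ n | ℕₚ.<⇒<ᵇ m<n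
... | true | _ = refl

<ᵇ-disjoint : ∀ x y i j → suc (i ℕ.+ j) ℕ.≤ x ℕ.+ y →
              (x ℕ.<ᵇ suc i) ∧ (y ℕ.<ᵇ suc j) ≡ false
<ᵇ-disjoint x y i j i+j<x+y
  with x ℕ.<ᵇ suc i | ℕₚ.<ᵇ⇒< x (suc i) | y ℕ.<ᵇ suc j | ℕₚ.<ᵇ⇒< y (suc j)
... | false | _   | _     | _   = refl
... | true  | _   | false | _   = refl
... | true  | x≤i | true  | y≤j = contradiction
  (ℕₚ.+-mono-≤ (ℕ.s≤s⁻¹ (x≤i _)) (ℕ.s≤s⁻¹ (y≤j _))) (ℕₚ.<⇒≱ i+j<x+y)

module _ (P : ProbabilitySpace) where
  open ProbabilitySpace P

  ℙ-complement : ∀ {A} → IsEvent A → ℙ A + ℙ (not ∘ A) ≤ 1ℝ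
  ℙ-complement {A} A-event = begin
    ℙ A + ℙ (not ∘ A)          ≲⟨ proj₂ (ℙ-additive A-event (event-∁ A-event) (∧-inverseʳ ∘ A)) ⟩
    ℙ (λ ω → A ω ∨ not (A ω))  ≲⟨ proj₁ (ℙ-cong (event-∪ A-event (event-∁ A-event)) event-Ω (∨-inverseʳ ∘ A)) ⟩
    ℙ (λ _ → true)             ≲⟨ proj₁ ℙ-Ω ⟩
    1ℝ                         ∎
    where open ℝ-Reasoning

  ℙ≤1 : ∀ {A} → IsEvent A → ℙ A ≤ 1ℝ
  ℙ≤1 {A} A-event = begin
    ℙ A                ≈⟨ (λ i → ℚₚ.+-identityʳ (seq (ℙ A) i)) ⟨
    ℙ A + 0ℝ           ≲⟨ +-monoʳ-≤ (ℙ A) 0ℝ (ℙ (not ∘ A)) (ℙ-nonneg (event-∁ A-event)) ⟩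
    ℙ A + ℙ (not ∘ A)  ≲⟨ ℙ-complement A-event ⟩
    1ℝ                 ∎
    where open ℝ-Reasoning

  ℙ-disjoint : ∀ {A B} → IsEvent A → IsEvent B →
               (∀ ω → A ω ∧ B ω ≡ false) → ℙ A + ℙ B ≤ 1ℝ
  ℙ-disjoint {A} {B} A-event B-event A∩B≡∅ = begin
    ℙ A + ℙ B            ≲⟨ proj₂ (ℙ-additive A-event B-event A∩B≡∅) ⟩
    ℙ (λ ω → A ω ∨ B ω)  ≲⟨ ℙ≤1 (event-∪ A-event B-event) ⟩
    1ℝ                   ∎
    where open ℝ-Reasoning

  module Distribution (X : BoundedRV P) where
    open BoundedRV X

    -- Strict, so that the induction showing these sets to be events starts from the empty set.
    below : ℕ → Ω → Bool
    below k ω = value ω ℕ.<ᵇ k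

    below-event : ∀ k → IsEvent (below k)
    below-event zero    = event-cong (λ _ → refl) (event-∁ event-Ω)
    below-event (suc k) = event-cong (λ ω → sym (<ᵇ-suc (value ω) k))
      (event-∪ (below-event k) (measurable k))

    ℙ[≡_] : ℕ → ℝ
    ℙ[≡ k ] = ℙ (λ ω → value ω ℕ.≡ᵇ k)

    -- The shift by one turns the strict event into X ≤ k.
    cdf : ℕ → ℝ
    cdf k = ℙ (below (suc k))

    ℙ-below-suc : ∀ k → ℙ (below (suc k)) ≤ ℙ (below k) + ℙ[≡ k ]
    ℙ-below-suc k = begin
      ℙ (below (suc k))
        ≲⟨ proj₁ (ℙ-cong (below-event (suc k)) (event-∪ (below-event k) (measurable k))
                         (λ ω → <ᵇ-suc (value ω) k)) ⟩
      ℙ (λ ω → below k ω ∨ (value ω ℕ.≡ᵇ k))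
        ≲⟨ proj₁ (ℙ-additive (below-event k) (measurable k) (λ ω → <ᵇ∧≡ᵇ≡false (value ω) k)) ⟩
      ℙ (below k) + ℙ[≡ k ] ∎
      where open ℝ-Reasoning

    1≤cdf : ∀ k → bound ℕ.≤ k → 1ℝ ≤ cdf k
    1≤cdf k bound≤k = begin
      1ℝ              ≲⟨ proj₂ ℙ-Ω ⟩
      ℙ (λ _ → true)  ≲⟨ proj₁ (ℙ-cong event-Ω (below-event (suc k)) λ ω →
                           sym (<⇒<ᵇ≡true (ℕ.s≤s (ℕₚ.≤-trans (bounded ω) bound≤k)))) ⟩
      cdf k           ∎
      where open ℝ-Reasoning

    -- Summation by parts: ℙ(X = k) is the increment of `cdf` at `k`, and the subtracted sum of
    -- `cdf` is moved to the other side.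
    abel-summation : ∀ b → fromℕ b * cdf b ≤
                     ∑[k≤ b ] (λ k → fromℕ k * ℙ[≡ k ]) + ∑[k< b ] cdf
    abel-summation zero    = ≐⇒≤ (fromℕ 0 * cdf 0) (fromℕ 0 * ℙ[≡ 0 ] + 0ℝ) λ i →
      trans (ℚₚ.*-zeroˡ (seq (cdf 0) i))
        (sym (trans (ℚₚ.+-identityʳ _) (ℚₚ.*-zeroˡ (seq ℙ[≡ 0 ] i))))
    abel-summation (suc b) = begin
      fromℕ (suc b) * cdf (suc b)
        ≲⟨ fromℕ-*-monoʳ-≤ (suc b) (cdf (suc b)) (cdf b + p) (ℙ-below-suc (suc b)) ⟩
      fromℕ (suc b) * (cdf b + p)
        ≈⟨ (λ i → ℚₚ.*-distribˡ-+ ((+ suc b) ℚ./ 1) (seq (cdf b) i) (seq p i)) ⟩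
      fromℕ (suc b) * cdf b + fromℕ (suc b) * p
        ≈⟨ (λ i → cong (ℚ._+ seq (fromℕ (suc b) * p) i) (suc-*-distrib b (cdf b) i)) ⟩
      (fromℕ b * cdf b + cdf b) + fromℕ (suc b) * p
        ≲⟨ +-monoˡ-≤ (fromℕ (suc b) * p) (fromℕ b * cdf b + cdf b) ((E + S) + cdf b)
             (+-monoˡ-≤ (cdf b) (fromℕ b * cdf b) (E + S) (abel-summation b)) ⟩
      ((E + S) + cdf b) + fromℕ (suc b) * p
        ≈⟨ (λ i → regroup (seq E i) (seq S i) (seq (cdf b) i) _) ⟩
      (E + fromℕ (suc b) * p) + (S + cdf b) ∎
      where
      p = ℙ[≡ suc b ]
      E = ∑[k≤ b ] (λ k → fromℕ k * ℙ[≡ k ])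
      S = ∑[k< b ] cdf
      open ℝ-Reasoning
      open ℚ-Solver.+-*-Solver
      regroup : ∀ a b c d → ((a ℚ.+ b) ℚ.+ c) ℚ.+ d ≡ (a ℚ.+ d) ℚ.+ (b ℚ.+ c)
      regroup = solve 4 (λ a b c d →
        ((a :+ b) :+ c) :+ d := (a :+ d) :+ (b :+ c)) refl

    private
      -- The claim `fromℕ m ≤ 𝔼+∑ m` is shown first at `m = bound`, where Abel summation applies
      -- with `cdf` at least 1, and then carried upwards and downwards.
      𝔼+∑ : ℕ → ℝ
      𝔼+∑ m = 𝔼 P X + ∑[k< m ] cdf

      assoc : ∀ m → 𝔼+∑ m + cdf m ≐ 𝔼+∑ (suc m)
      assoc m i = ℚₚ.+-assoc (seq (𝔼 P X) i) (seq (∑[k< m ] cdf) i) (seq (cdf m) i)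

      at-bound : fromℕ bound ≤ 𝔼+∑ bound
      at-bound = begin
        fromℕ bound              ≈⟨ (λ _ → ℚₚ.*-identityʳ ((+ bound) ℚ./ 1)) ⟨
        fromℕ bound * 1ℝ         ≲⟨ fromℕ-*-monoʳ-≤ bound 1ℝ (cdf bound) (1≤cdf bound ℕₚ.≤-refl) ⟩
        fromℕ bound * cdf bound  ≲⟨ abel-summation bound ⟩
        𝔼+∑ bound                ∎
        where open ℝ-Reasoning

      -- From `bound` on, `cdf` is at least 1, so the right side gains at least as much as the left.
      step-up : ∀ m → bound ℕ.≤ m → fromℕ m ≤ 𝔼+∑ m → fromℕ (suc m) ≤ 𝔼+∑ (suc m)
      step-up m bound≤m h = begin
        fromℕ (suc m)     ≈⟨ fromℕ-suc m ⟩
        fromℕ m + 1ℝ      ≲⟨ +-mono-≤ (fromℕ m) (𝔼+∑ m) 1ℝ (cdf m) h (1≤cdf m bound≤m) ⟩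
        𝔼+∑ m + cdf m     ≈⟨ assoc m ⟩
        𝔼+∑ (suc m)       ∎
        where open ℝ-Reasoning

      -- As a probability, `cdf m` is at most 1, so the right side loses no more than the left.
      step-down : ∀ m → fromℕ (suc m) ≤ 𝔼+∑ (suc m) → fromℕ m ≤ 𝔼+∑ m
      step-down m h = +-cancelʳ-≤ 1ℝ (fromℕ m) (𝔼+∑ m) (begin
        fromℕ m + 1ℝ   ≈⟨ fromℕ-suc m ⟨
        fromℕ (suc m)  ≲⟨ h ⟩
        𝔼+∑ (suc m)    ≈⟨ assoc m ⟨
        𝔼+∑ m + cdf m  ≲⟨ +-monoʳ-≤ (𝔼+∑ m) (cdf m) 1ℝ (ℙ≤1 (below-event (suc m))) ⟩
        𝔼+∑ m + 1ℝ     ∎)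
        where open ℝ-Reasoning

      -- Climbing from `bound` to `m + bound` and then descending `bound` steps reaches every `m`,
      -- without comparing `m` with `bound`.
      above : ∀ j → fromℕ (j ℕ.+ bound) ≤ 𝔼+∑ (j ℕ.+ bound)
      above zero    = at-bound
      above (suc j) = step-up (j ℕ.+ bound) (ℕₚ.m≤n+m bound j) (above j)

      descend : ∀ j m → fromℕ (j ℕ.+ m) ≤ 𝔼+∑ (j ℕ.+ m) → fromℕ m ≤ 𝔼+∑ m
      descend zero    m h = h
      descend (suc j) m h = descend j m (step-down (j ℕ.+ m) h)

    -- In effect 𝔼 X ≥ 𝔼 (min X m) = ∑_{k<m} (1 − ℙ(X ≤ k)).
    𝔼-layer-cake : ∀ m → fromℕ m ≤ 𝔼 P X + ∑[k< m ] cdf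
    𝔼-layer-cake m = descend bound m
      (subst (λ j → fromℕ j ≤ 𝔼+∑ j) (ℕₚ.+-comm m bound) (above m))

  -- For i + j < m the events X ≤ i and Y ≤ j are disjoint, so that the layer
  -- cake formula applies to X and Y separately: no joint distribution of
  -- X and Y is needed.
  𝔼-superadditive : ∀ (X Y : BoundedRV P) m →
    (∀ ω → m ℕ.≤ BoundedRV.value X ω ℕ.+ BoundedRV.value Y ω) →
    fromℕ m ≤ 𝔼 P X + 𝔼 P Y
  𝔼-superadditive X Y m m≤X+Y = +-cancelʳ-≤ (fromℕ m) (fromℕ m) (𝔼 P X + 𝔼 P Y) (begin
    fromℕ m + fromℕ m
      ≲⟨ +-mono-≤ (fromℕ m) (𝔼 P X + SX) (fromℕ m) (𝔼 P Y + SY)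
           (𝔼-layer-cake X m) (𝔼-layer-cake Y m) ⟩
    (𝔼 P X + SX) + (𝔼 P Y + SY)
      ≈⟨ (λ i → regroup (seq (𝔼 P X) i) (seq SX i) (seq (𝔼 P Y) i) (seq SY i)) ⟩
    (𝔼 P X + 𝔼 P Y) + (SX + SY)
      ≲⟨ +-monoʳ-≤ (𝔼 P X + 𝔼 P Y) (SX + SY) (fromℕ m)
           (∑-antidiagonal-≤ m (cdf X) (cdf Y) λ i j i+j+1≡m →
             ℙ-disjoint (below-event X (suc i)) (below-event Y (suc j)) λ ω →
               <ᵇ-disjoint (BoundedRV.value X ω) (BoundedRV.value Y ω) i j
                 (ℕₚ.≤-trans (ℕₚ.≤-reflexive i+j+1≡m) (m≤X+Y ω))) ⟩
    (𝔼 P X + 𝔼 P Y) + fromℕ m ∎)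
    where
    open Distribution
    SX = ∑[k< m ] (cdf X)
    SY = ∑[k< m ] (cdf Y)
    open ℝ-Reasoning
    open ℚ-Solver.+-*-Solver
    regroup : ∀ a b c d → (a ℚ.+ b) ℚ.+ (c ℚ.+ d) ≡ (a ℚ.+ c) ℚ.+ (b ℚ.+ d)
    regroup = solve 4 (λ a b c d →
      (a :+ b) :+ (c :+ d) := (a :+ c) :+ (b :+ d)) refl

-- Page migration costs

lookup-++-prefix : ∀ {A : Set} {m n} (xs : Vec A m) (ys zs : Vec A n) i → toℕ i ℕ.< m →
                   lookup (xs ++ ys) i ≡ lookup (xs ++ zs) i
lookup-++-prefix xs ys zs i i<m =
  trans (lookup-++-< xs ys i i<m) (sym (lookup-++-< xs zs i i<m))

module _ (X : UniformMetricSpace) (D : ℕ) where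
  open UniformMetricSpace X
  open IsMetric isMetric using (triangle) renaming (sym to d-sym)

  -- Changing the position from `p` to `a` saves at most `d p a` on each of `m` requests at `x`. As
  -- `m ≤ D`, the price of the move covers the saving.
  *-triangle : ∀ {m} p a x → m ℕ.≤ D → m ℕ.* d p x ℕ.≤ D ℕ.* d p a ℕ.+ m ℕ.* d a x
  *-triangle {m} p a x m≤D = begin
    m ℕ.* d p x                  ≤⟨ ℕₚ.*-monoʳ-≤ m (triangle p a x) ⟩
    m ℕ.* (d p a ℕ.+ d a x)      ≡⟨ ℕₚ.*-distribˡ-+ m (d p a) (d a x) ⟩
    m ℕ.* d p a ℕ.+ m ℕ.* d a x  ≤⟨ ℕₚ.+-monoˡ-≤ (m ℕ.* d a x) (ℕₚ.*-monoˡ-≤ (d p a) m≤D) ⟩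
    D ℕ.* d p a ℕ.+ m ℕ.* d a x  ∎
    where open ℕₚ.≤-Reasoning

  -- A run of at most `D` equal requests is too short for a move to pay off, so staying at `p` is
  -- optimal. The potential `m * d p x` of the remaining requests is carried along by `*-triangle`.
  cost-replicate-≥ : ∀ m p x as → m ℕ.≤ D → m ℕ.* d p x ℕ.≤ cost X D p as (replicate m x)
  cost-replicate-≥ zero    p x []       _   = ℕ.z≤n
  cost-replicate-≥ (suc m) p x (a ∷ as) m<D = begin
    suc m ℕ.* d p x
      ≤⟨ *-triangle p a x m<D ⟩
    D ℕ.* d p a ℕ.+ (d a x ℕ.+ m ℕ.* d a x)
      ≡⟨ ℕₚ.+-assoc (D ℕ.* d p a) (d a x) (m ℕ.* d a x) ⟨
    D ℕ.* d p a ℕ.+ d a x ℕ.+ m ℕ.* d a x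
      ≤⟨ ℕₚ.+-monoʳ-≤ (D ℕ.* d p a ℕ.+ d a x) (cost-replicate-≥ m a x as (ℕₚ.<⇒≤ m<D)) ⟩
    D ℕ.* d p a ℕ.+ d a x ℕ.+ cost X D a as (replicate m x) ∎
    where open ℕₚ.≤-Reasoning

  cost-++-≥ : ∀ p {m n} (as ss : Vec Point m) (bs ts : Vec Point n) →
              cost X D p as ss ℕ.≤ cost X D p (as ++ bs) (ss ++ ts)
  cost-++-≥ p []       []       bs ts = ℕ.z≤n
  cost-++-≥ p (a ∷ as) (s ∷ ss) bs ts =
    ℕₚ.+-monoʳ-≤ (D ℕ.* d p a ℕ.+ d a s) (cost-++-≥ a as ss bs ts)

  cost-stay-++ : ∀ p m x {n} (ts : Vec Point n) →
    cost X D p (replicate (m ℕ.+ n) p) (replicate m x ++ ts) ≡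
    m ℕ.* d p x ℕ.+ cost X D p (replicate n p) ts
  cost-stay-++ p zero    x ts = refl
  cost-stay-++ p (suc m) x ts
    rewrite ≈⇒0 {p} refl | ℕₚ.*-zeroʳ D | cost-stay-++ p m x ts =
    sym (ℕₚ.+-assoc (d p x) (m ℕ.* d p x) _)

  cost-stay : ∀ p n → cost X D p (replicate n p) (replicate n p) ≡ 0
  cost-stay p zero = refl
  cost-stay p (suc n) rewrite ≈⇒0 {p} refl | ℕₚ.*-zeroʳ D = cost-stay p n

  -- Only an inequality, since an empty request sequence causes no move.
  cost-move-≤ : ∀ p x {n} (ss : Vec Point n) →
    cost X D p (replicate n x) ss ℕ.≤ D ℕ.* d p x ℕ.+ cost X D x (replicate n x) ss
  cost-move-≤ p x []       = ℕ.z≤n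
  cost-move-≤ p x (s ∷ ss) rewrite ≈⇒0 {x} refl | ℕₚ.*-zeroʳ D =
    ℕₚ.≤-reflexive (ℕₚ.+-assoc (D ℕ.* d p x) (d x s) _)

  -- Induction along the common prefix with the potential `2 * (m * d p x)`, one copy per run;
  -- `*-triangle` transfers it from the current position to the next one.
  diverging-costs : ∀ m k p x y (as bs : Vec Point (m ℕ.+ k)) → m ℕ.≤ D → k ℕ.≤ D →
    (∀ i → toℕ i ℕ.< m → lookup as i ≡ lookup bs i) →
    2 ℕ.* (m ℕ.* d p x) ℕ.+ k ℕ.* d x y ℕ.≤
    cost X D p as (replicate m x ++ replicate k x) ℕ.+
    cost X D p bs (replicate m x ++ replicate k y)
  -- At the fork both runs stand at the same `p`. The two continuations cost at least `k * d p x`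
  -- and `k * d p y`, and the triangle inequality through `p` bounds the sum from below.
  diverging-costs zero    k p x y as bs _ k≤D _ = begin
    k ℕ.* d x y
      ≤⟨ ℕₚ.*-monoʳ-≤ k (triangle x p y) ⟩
    k ℕ.* (d x p ℕ.+ d p y)
      ≡⟨ cong (λ e → k ℕ.* (e ℕ.+ d p y)) (d-sym x p) ⟩
    k ℕ.* (d p x ℕ.+ d p y)
      ≡⟨ ℕₚ.*-distribˡ-+ k (d p x) (d p y) ⟩
    k ℕ.* d p x ℕ.+ k ℕ.* d p y
      ≤⟨ ℕₚ.+-mono-≤ (cost-replicate-≥ k p x as k≤D) (cost-replicate-≥ k p y bs k≤D) ⟩
    cost X D p as (replicate k x) ℕ.+ cost X D p bs (replicate k y) ∎
    where open ℕₚ.≤-Reasoning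
  diverging-costs (suc m) k p x y (a ∷ as) (b ∷ bs) m<D k≤D agree
    -- Before the fork both runs choose the same point, so the same move and the same service are
    -- paid twice.
    with refl ← agree zero (ℕ.s≤s ℕ.z≤n) = begin
    2 ℕ.* (suc m ℕ.* d p x) ℕ.+ R
      ≤⟨ ℕₚ.+-monoˡ-≤ R (ℕₚ.*-monoʳ-≤ 2 (*-triangle p a x m<D)) ⟩
    2 ℕ.* (U ℕ.+ (d a x ℕ.+ m ℕ.* d a x)) ℕ.+ R
      ≡⟨ solve 4 (λ u e f r → con 2 :* (u :+ (e :+ f)) :+ r :=
                 ((u :+ e) :+ (u :+ e)) :+ (con 2 :* f :+ r)) refl U (d a x) (m ℕ.* d a x) R ⟩
    (V ℕ.+ V) ℕ.+ (2 ℕ.* (m ℕ.* d a x) ℕ.+ R)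
      ≤⟨ ℕₚ.+-monoʳ-≤ (V ℕ.+ V)
           (diverging-costs m k a x y as bs (ℕₚ.<⇒≤ m<D) k≤D
             (λ i i<m → agree (suc i) (ℕ.s≤s i<m))) ⟩
    (V ℕ.+ V) ℕ.+ (c₁ ℕ.+ c₂)
      ≡⟨ solve 3 (λ v a b → (v :+ v) :+ (a :+ b) := (v :+ a) :+ (v :+ b)) refl V c₁ c₂ ⟩
    (V ℕ.+ c₁) ℕ.+ (V ℕ.+ c₂) ∎
    where
    R = k ℕ.* d x y
    U = D ℕ.* d p a
    V = U ℕ.+ d a x
    c₁ = cost X D a as (replicate m x ++ replicate k x)
    c₂ = cost X D a bs (replicate m x ++ replicate k y)
    open ℕₚ.≤-Reasoning
    open ℕ-Solver.+-*-Solver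

  -- The first `D` requests alone force the cost `D * d p x`, whatever follows; a single sequence
  -- attaining this value therefore settles the infimum.
  optimum : ∀ p x {n} (ts : Vec Point n) (a : Vec Point (D ℕ.+ n)) →
            cost X D p a (replicate D x ++ ts) ℕ.≤ D ℕ.* d p x →
            IsOfflineOptimum X D p (replicate D x ++ ts) (D ℕ.* d p x)
  optimum p x {n} ts a attained = lower , λ l l≤ → ℕₚ.≤-trans (l≤ a) attained
    where
    lower : ∀ a → D ℕ.* d p x ℕ.≤ cost X D p a (replicate D x ++ ts)
    lower a with as , bs , refl ← splitAt D a = ℕₚ.≤-trans
      (cost-replicate-≥ D p x as ℕₚ.≤-refl)
      (cost-++-≥ p as (replicate D x) bs ts)

  optimum-move : ∀ p x k → IsOfflineOptimum X D p (replicate D x ++ replicate k x) (D ℕ.* d p x)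
  optimum-move p x k = optimum p x (replicate k x) (replicate (D ℕ.+ k) x) (begin
    cost X D p (replicate (D ℕ.+ k) x) ss
      ≤⟨ cost-move-≤ p x ss ⟩
    D ℕ.* d p x ℕ.+ cost X D x (replicate (D ℕ.+ k) x) ss
      ≡⟨ cong (D ℕ.* d p x ℕ.+_) (cost-stay-++ x D x (replicate k x)) ⟩
    D ℕ.* d p x ℕ.+ (D ℕ.* d x x ℕ.+ cost X D x (replicate k x) (replicate k x))
      ≡⟨ cong₂ (λ e c → D ℕ.* d p x ℕ.+ (e ℕ.+ c))
           (trans (cong (D ℕ.*_) (≈⇒0 refl)) (ℕₚ.*-zeroʳ D)) (cost-stay x k) ⟩
    D ℕ.* d p x ℕ.+ 0
      ≡⟨ ℕₚ.+-identityʳ _ ⟩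
    D ℕ.* d p x ∎)
    where
    ss = replicate D x ++ replicate k x
    open ℕₚ.≤-Reasoning

  optimum-stay : ∀ p x k → IsOfflineOptimum X D p (replicate D x ++ replicate k p) (D ℕ.* d p x)
  optimum-stay p x k = optimum p x (replicate k p) (replicate (D ℕ.+ k) p) (ℕₚ.≤-reflexive
    (trans (cost-stay-++ p D x (replicate k p))
      (trans (cong (D ℕ.* d p x ℕ.+_) (cost-stay p k)) (ℕₚ.+-identityʳ _))))

-- The two adversarial inputs

-- The first `m` entries are rejected one by one; at most the other `k` can survive.
length-filter-tabulate-≤ : ∀ {A : Set} {P : A → Set} (P? : Decidable P) m {k}
  (f : Fin (m ℕ.+ k) → A) → (∀ i → P (f i) → m ℕ.≤ toℕ i) →
  List.length (List.filter P? (List.tabulate f)) ℕ.≤ k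
length-filter-tabulate-≤ P? zero f h = ℕₚ.≤-trans
  (Listₚ.length-filter P? (List.tabulate f)) (ℕₚ.≤-reflexive (Listₚ.length-tabulate f))
length-filter-tabulate-≤ P? (suc m) f h
  rewrite Listₚ.filter-reject P? {xs = List.tabulate (f ∘ suc)} (λ Pf0 → contradiction (h zero Pf0) λ ()) =
  length-filter-tabulate-≤ P? m (f ∘ suc) (λ i Pfi → ℕ.s≤s⁻¹ (h (suc i) Pfi))

-- The sequences share the prefix `xs`, so all mismatches lie among the last `k` indices, and
-- restricting to a window only removes some of them.
mismatches-++-≤ : ∀ (X : UniformMetricSpace) → let open UniformMetricSpace X in
  ∀ p {m k} (xs : Vec Point m) (ŷ y : Vec Point k) t L →
  mismatches (record { space = X ; p₀ = p ; n = m ℕ.+ k ; ŝ = xs ++ ŷ ; s = xs ++ y }) t L ℕ.≤ k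
mismatches-++-≤ X p {m} xs ŷ y t L = length-filter-tabulate-≤ _ m id
  λ i (_ , sᵢ≢ŝᵢ) → ℕₚ.≮⇒≥ (λ i<m → sᵢ≢ŝᵢ (lookup-++-prefix xs y ŷ i i<m))

bool-space : UniformMetricSpace
bool-space = record
  { Point    = Bool
  ; d        = d
  ; isMetric = record
    { isSemiMetric = record
      { isQuasiSemiMetric = record
        { isPreMetric = record
          { isProtoMetric = record
            { isPartialOrder  = ℕₚ.≤-isPartialOrder
            ; ≈-isEquivalence = isEquivalence
            ; cong            = cong₂ d
            ; nonNegative     = ℕ.z≤n
            }
          ; ≈⇒0 = λ { {false} refl → refl ; {true} refl → refl }
          }
        ; 0⇒≈ = λ { {false} {false} _ → refl ; {true} {true} _ → refl
                  ; {false} {true} () ; {true} {false} () }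
        }
      ; sym = λ { false false → refl ; false true → refl
                ; true false → refl ; true true → refl }
      }
    ; triangle = λ { false false _ → ℕₚ.≤-refl ; true true _ → ℕₚ.≤-refl
                   ; false true false → ℕ.z≤n ; false true true → ℕₚ.≤-refl
                   ; true false false → ℕₚ.≤-refl ; true false true → ℕ.z≤n }
    }
  ; uniform = λ { {false} {false} p≢p → contradiction refl p≢p ; {false} {true} _ → refl
                ; {true} {false} _ → refl ; {true} {true} p≢p → contradiction refl p≢p }
  }
  where
  d : Bool → Bool → ℕ
  d false false = 0
  d false true  = 1
  d true  false = 1
  d true  true  = 0

adversary : ℕ → ℕ → Bool → Input
adversary D k z = record
  { space = bool-space
  ; p₀    = false
  ; n     = D ℕ.+ k
  ; ŝ     = replicate D true ++ replicate k true
  ; s     = replicate D true ++ replicate k z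
  }

adversary-optimum : ∀ D k z →
  IsOfflineOptimum bool-space D false (Input.s (adversary D k z)) D
adversary-optimum D k true  = subst (IsOfflineOptimum bool-space D false _)
  (ℕₚ.*-identityʳ D) (optimum-move bool-space D false true k)
adversary-optimum D k false = subst (IsOfflineOptimum bool-space D false _)
  (ℕₚ.*-identityʳ D) (optimum-stay bool-space D false true k)

adversary-expectedCost : ∀ {D k} → k ℕ.≤ D → (A : OnlineAlgorithmOn bool-space D) →
  let open OnlineAlgorithmOn A
      open Input (adversary D k true) using (ŝ)
      s : Bool → Vec Bool (D ℕ.+ k)
      s z = Input.s (adversary D k z)
  in fromℕ (2 ℕ.* D ℕ.+ k) ≤ expectedCost false (D ℕ.+ k) ŝ (s true) +
                             expectedCost false (D ℕ.+ k) ŝ (s false)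
adversary-expectedCost {D} {k} k≤D A = 𝔼-superadditive randomness
  (costRV false (D ℕ.+ k) ŝ (s true)) (costRV false (D ℕ.+ k) ŝ (s false)) (2 ℕ.* D ℕ.+ k)
  λ ω → begin
    2 ℕ.* D ℕ.+ k
      ≡⟨ cong₂ (λ a b → 2 ℕ.* a ℕ.+ b) (ℕₚ.*-identityʳ D) (ℕₚ.*-identityʳ k) ⟨
    2 ℕ.* (D ℕ.* 1) ℕ.+ k ℕ.* 1
      ≤⟨ diverging-costs bool-space D D k false true false
           (positions false (D ℕ.+ k) ŝ (s true) ω)
           (positions false (D ℕ.+ k) ŝ (s false) ω)
           ℕₚ.≤-refl k≤D
           -- The position at `i < D` depends only on requests up to `i`, all of which lie in the
           -- common prefix.
           (λ i i<D → online false (D ℕ.+ k) ŝ (s true) (s false) ω i λ j j≤i →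
             lookup-++-prefix (replicate D true) (replicate k true) (replicate k false) j
               (ℕₚ.≤-<-trans j≤i i<D)) ⟩
    _ ∎
  where
  open OnlineAlgorithmOn A
  open Input (adversary D k true) using (ŝ)
  s : Bool → Vec Bool (D ℕ.+ k)
  s z = Input.s (adversary D k z)
  open ℕₚ.≤-Reasoning

-- Averaging over the two inputs

mainTheorem3 : Σ[ c ∈ ℝ ] (0ℝ < c ×
    (∀ (q : ℝ) → 0ℝ < q → q < 1ℝ →
    ∀ (D : ℕ) → 1 ℕ.< D →
    ∃[ k ] (0 ℕ.< k × q * fromℕ D ≃ fromℕ k) →
    ∀ (alg : OnlineAlgorithm D) →
    CompetitiveRatioAtLeast alg (MismatchesBounded q D) (1ℝ + c * q)))
-- The two expected costs sum to at least 2D + k = (2 + q) D while each optimum is D, so averaging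
-- yields 1 + q/2, whence c = 1/2.
mainTheorem3 = fromℚ ½ , (½ , ℚₚ.positive⁻¹ ½ , 0 , λ _ _ → ℚₚ.≤-refl) , bound
  where
  bound : ∀ (q : ℝ) → 0ℝ < q → q < 1ℝ →
    ∀ (D : ℕ) → 1 ℕ.< D →
    ∃[ k ] (0 ℕ.< k × q * fromℕ D ≃ fromℕ k) →
    ∀ (alg : OnlineAlgorithm D) →
    CompetitiveRatioAtLeast alg (MismatchesBounded q D) (1ℝ + fromℚ ½ * q)
  bound q _ q<1 D 1<D (k , _ , qD≤k , k≤qD) alg ρ competitive =
    -- Both sides are compared after multiplication by 2D, the sum of the two optima.
    *-cancelʳ-≤-pos (D′ ℚ.+ D′) (1ℝ + fromℚ ½ * q) ρ (begin
      (1ℝ + fromℚ ½ * q) * fromℚ (D′ ℚ.+ D′)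
        ≈⟨ (λ i → expand (seq q i) D′) ⟩
      (fromℕ D + (fromℕ D + 0ℝ)) + q * fromℕ D
        ≲⟨ +-monoʳ-≤ (fromℕ D + (fromℕ D + 0ℝ)) (q * fromℕ D) (fromℕ k) qD≤k ⟩
      (fromℕ D + (fromℕ D + 0ℝ)) + fromℕ k
        ≈⟨ (λ i → cong (ℚ._+ (+ k) ℚ./ 1)
             (trans (/1-homo-+ D (D ℕ.+ 0)) (cong (D′ ℚ.+_) (/1-homo-+ D 0)))) ⟨
      fromℕ (2 ℕ.* D) + fromℕ k
        ≈⟨ fromℕ-homo-+ (2 ℕ.* D) k ⟨
      fromℕ (2 ℕ.* D ℕ.+ k)
        ≲⟨ adversary-expectedCost k≤D (alg bool-space) ⟩
      E true + E false
        ≲⟨ +-mono-≤ (E true) (ρ * fromℕ D) (E false) (ρ * fromℕ D) (E≤ρD true) (E≤ρD false) ⟩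
      ρ * fromℕ D + ρ * fromℕ D
        ≈⟨ (λ i → ℚₚ.*-distribˡ-+ (seq ρ i) D′ D′) ⟨
      ρ * fromℚ (D′ ℚ.+ D′) ∎)
    where
    open ℝ-Reasoning
    D′ = (+ D) ℚ./ 1

    instance
      D≢0 : ℕ.NonZero D
      D≢0 = ℕ.>-nonZero (ℕₚ.<⇒≤ 1<D)
      D′-positive : ℚ.Positive D′
      D′-positive = ℚₚ.normalize-pos D 1
      2D′-positive : ℚ.Positive (D′ ℚ.+ D′)
      2D′-positive = ℚₚ.pos+pos⇒pos D′ D′

    E : Bool → ℝ
    E z = OnlineAlgorithmOn.expectedCost (alg bool-space) false (D ℕ.+ k)
            (Input.ŝ (adversary D k z)) (Input.s (adversary D k z))

    E≤ρD : ∀ z → E z ≤ ρ * fromℕ D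
    E≤ρD z = competitive (adversary D k z)
      -- Any window holds at most `k` mismatches, and `k` equals `qD`.
      (λ t _ → ≤-trans (fromℕ (mismatches (adversary D k z) t D)) (fromℕ k) (q * fromℕ D)
        (fromℕ-mono-≤ (mismatches-++-≤ bool-space false
          (replicate D true) (replicate k true) (replicate k z) t D))
        k≤qD)
      D (adversary-optimum D k z)

    -- From `q < 1`; it makes the suffix short enough for `diverging-costs`.
    k≤D : k ℕ.≤ D
    k≤D = fromℕ-cancel-≤ (begin
      fromℕ k      ≲⟨ k≤qD ⟩
      q * fromℕ D  ≈⟨ (λ i → ℚₚ.*-comm (seq q i) D′) ⟩
      fromℕ D * q  ≲⟨ fromℕ-*-monoʳ-≤ D q 1ℝ (<⇒≤ q 1ℝ q<1) ⟩
      fromℕ D * 1ℝ ≈⟨ (λ _ → ℚₚ.*-identityʳ D′) ⟩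
      fromℕ D      ∎)

    -- The summand `e + (e + 0)` mirrors how `2 * D` unfolds in ℕ.
    expand : ∀ a e → (1ℚ ℚ.+ ½ ℚ.* a) ℚ.* (e ℚ.+ e) ≡ (e ℚ.+ (e ℚ.+ 0ℚ)) ℚ.+ a ℚ.* e
    expand = solve 2 (λ a e → (con 1ℚ :+ con ½ :* a) :* (e :+ e) :=
      (e :+ (e :+ con 0ℚ)) :+ a :* e) refl
      where open ℚ-Solver.+-*-Solver
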